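{- Assume (i) the Singer family hypothesis: for every prime $p$ there is a finite $S\subseteq\mathbb{Z}$ with $|S|=p+1$ that is Sidon modulo $p^2+p+1$; and (ii) the subpolynomial prime gap hypothesis: for every real $\delta>0$ there exists $x_0$ such that for every natural number $x\ge x_0$ there is a prime $p$ with $x-x^{\delta}<p\le x$. Then for every real $\varepsilon>0$ there exist $C\ge0$ and $N_0\in\mathbb{N}$ such that $h(N)\ge\sqrt{N}-C N^{\varepsilon}$ for all $N\ge N_0$.
   Context: A finite set $A\subseteq\mathbb{Z}$ is Sidon if $a+b=c+d$ with $a,b,c,d\in A$ implies $\{a,b\}=\{c,d\}$ as unordered pairs; for a positive integer $M$ it is Sidon modulo $M$ if $M\mid (a+b)-(c+d)$ with $a,b,c,d\in A$ implies $\{a,b\}=\{c,d\}$ as unordered pairs. For a natural number $N$, $h(N)=\max\{|A| : A\subseteq\{1,\dots,N\},\ A\text{ Sidon}\}$. -}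

module Defs where

import Algebra.Definitions.RawSemiring as RawSemiring
import Algebra.Properties.CommutativeSemiring.Exp as Exp
open import Algebra.Bundles using (CommutativeRing)
open import Data.Empty using (⊥-elim)
open import Data.Integer as ℤ using (ℤ; +_; +[1+_]; -[1+_])
import Data.Integer.Divisibility as ℤ
import Data.Integer.Properties as ℤ
open import Data.List using (List; []; _∷_; _++_; map; filter; foldr; length; upTo)
open import Data.List.Membership.Propositional using (_∈_)
open import Data.List.Relation.Unary.All as All using (All; all?)
open import Data.Nat as ℕ using (ℕ; zero; suc)
open import Data.Nat.Coprimality as Coprime using (1-coprimeTo)
import Data.Nat.Properties as ℕ
open import Data.Product using (∃; ∃₂; _×_; _,_; proj₁; proj₂)
open import Data.Rational as ℚ using (ℚ; 0ℚ; 1ℚ; ½)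
import Data.Rational.Properties as ℚ
open import Data.Rational.Solver using (module +-*-Solver)
open import Data.Rational.Unnormalised as ℚᵘ using (mkℚᵘ)
import Data.Rational.Unnormalised.Properties as ℚᵘ
open import Data.Sum using (_⊎_; inj₁; inj₂; swap; [_,_]′)
open import Relation.Binary using (tri<; tri≈; tri>)
open import Relation.Binary.PropositionalEquality
open import Relation.Nullary using (¬_; Dec; yes; no)
open import Relation.Nullary.Decidable using (map′; _→-dec_; _×-dec_; _⊎-dec_)

-- Finite sets of integers are lists, with duplicate-freeness (Unique) required
-- wherever cardinality matters.

SamePair : (a b c d : ℤ) → Set
SamePair a b c d = (a ≡ c × b ≡ d) ⊎ (a ≡ d × b ≡ c)

Sidon : List ℤ → Set
Sidon A = ∀ {a b c d} → a ∈ A → b ∈ A → c ∈ A → d ∈ A →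
  a ℤ.+ b ≡ c ℤ.+ d → SamePair a b c d

SidonMod : ℕ → List ℤ → Set
SidonMod M A = ∀ {a b c d} → a ∈ A → b ∈ A → c ∈ A → d ∈ A →
  + M ℤ.∣ (a ℤ.+ b) ℤ.- (c ℤ.+ d) → SamePair a b c d

sidon? : ∀ A → Dec (Sidon A)
sidon? A = map′
  (λ h a∈ b∈ c∈ d∈ → All.lookup (All.lookup (All.lookup (All.lookup h a∈) b∈) c∈) d∈)
  (λ h → All.tabulate λ a∈ → All.tabulate λ b∈ → All.tabulate λ c∈ → All.tabulate λ d∈ →
    h a∈ b∈ c∈ d∈)
  (all? (λ a → all? (λ b → all? (λ c → all? (λ d →
    (a ℤ.+ b ℤ.≟ c ℤ.+ d) →-dec
    ((a ℤ.≟ c ×-dec b ℤ.≟ d) ⊎-dec (a ℤ.≟ d ×-dec b ℤ.≟ c))) A) A) A) A)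

sublists : ∀ {A : Set} → List A → List (List A)
sublists []       = [] ∷ []
sublists (x ∷ xs) = sublists xs ++ map (x ∷_) (sublists xs)

[1⋯_] : ℕ → List ℤ
[1⋯ N ] = map (λ i → + suc i) (upTo N)

-- Since [1⋯ N ] has no repetitions, each subset of {1,…,N} is listed exactly
-- once in sublists [1⋯ N ].
h : ℕ → ℕ
h N = foldr ℕ._⊔_ 0 (map length (filter sidon? (sublists [1⋯ N ])))

open RawSemiring ℚ.+-*-rawSemiring public using () renaming (_^_ to _^ℚ_)

ℕ⇒ℚ : ℕ → ℚ
ℕ⇒ℚ n = ℚ.mkℚ (+ n) 0 (Coprime.sym (1-coprimeTo n))

-- Used only to show that the operations on cuts below yield cuts.

module RationalLemmas where
  open import Data.Rational
  private
    module E = Exp (CommutativeRing.commutativeSemiring ℚ.+-*-commutativeRing)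
  open +-*-Solver

  ≤-by : ∀ {a b} e → 0ℚ ≤ e → a + e ≡ b → a ≤ b
  ≤-by {a} e 0≤e refl = subst (_≤ a + e) (ℚ.+-identityʳ a) (ℚ.+-monoʳ-≤ a 0≤e)

  <-by : ∀ {a b} e → 0ℚ < e → a + e ≡ b → a < b
  <-by {a} e 0<e refl = subst (_< a + e) (ℚ.+-identityʳ a) (ℚ.+-monoʳ-< a 0<e)

  ≤⇒0≤- : ∀ {a b} → a ≤ b → 0ℚ ≤ b - a
  ≤⇒0≤- {a} {b} a≤b = subst (_≤ b - a) (ℚ.+-inverseʳ a) (ℚ.+-monoˡ-≤ (- a) a≤b)

  <⇒0<- : ∀ {a b} → a < b → 0ℚ < b - a
  <⇒0<- {a} {b} a<b = subst (_< b - a) (ℚ.+-inverseʳ a) (ℚ.+-monoˡ-< (- a) a<b)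

  0≤+ : ∀ {a b} → 0ℚ ≤ a → 0ℚ ≤ b → 0ℚ ≤ a + b
  0≤+ = ℚ.+-mono-≤

  0≤* : ∀ {a b} → 0ℚ ≤ a → 0ℚ ≤ b → 0ℚ ≤ a * b
  0≤* {a} {b} 0≤a 0≤b =
    ℚ.nonNegative⁻¹ (a * b) {{ℚ.nonNeg*nonNeg⇒nonNeg a {{nonNegative 0≤a}} b {{nonNegative 0≤b}}}}

  0<* : ∀ {a b} → 0ℚ < a → 0ℚ < b → 0ℚ < a * b
  0<* {a} {b} 0<a 0<b =
    ℚ.positive⁻¹ (a * b) {{ℚ.pos*pos⇒pos a {{positive 0<a}} b {{positive 0<b}}}}

  *-mono-≤ : ∀ {a b c d} → 0ℚ ≤ a → a ≤ b → 0ℚ ≤ c → c ≤ d → a * c ≤ b * d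
  *-mono-≤ {a} {b} {c} {d} 0≤a a≤b 0≤c c≤d = ℚ.≤-trans
    (ℚ.*-monoʳ-≤-nonNeg c {{nonNegative 0≤c}} a≤b)
    (ℚ.*-monoˡ-≤-nonNeg b {{nonNegative (ℚ.≤-trans 0≤a a≤b)}} c≤d)

  half : ∀ {e} → 0ℚ < e → ∃ λ e′ → 0ℚ < e′ × e′ + e′ ≡ e
  half {e} 0<e = ½ * e , 0<* (ℚ.positive⁻¹ ½) 0<e ,
    solve 1 (λ e → con ½ :* e :+ con ½ :* e := e) refl e

  ÷-* : ∀ a {b} (0<b : 0ℚ < b) → ∃ λ c → c * b ≡ a × (0ℚ < a → 0ℚ < c)
  ÷-* a {b} 0<b = a * 1/b , eq , λ 0<a → 0<* 0<a (ℚ.positive⁻¹ 1/b {{ℚ.1/pos⇒pos b}})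
    where
    instance
      pb  = positive 0<b
      nzb = ℚ.pos⇒nonZero b
    1/b = 1/ b
    eq : a * 1/b * b ≡ a
    eq = trans (ℚ.*-assoc a 1/b b) (trans (cong (a *_) (ℚ.*-inverseˡ b)) (ℚ.*-identityʳ a))

  abs-≤ : ∀ {a k} → - k ≤ a → a ≤ k → ∣ a ∣ ≤ k
  abs-≤ {a} {k} lo hi with ℚ.∣p∣≡p∨∣p∣≡-p a
  ... | inj₁ eq = subst (_≤ k) (sym eq) hi
  ... | inj₂ eq = subst (_≤ k) (sym eq)
    (subst (- a ≤_) (solve 1 (λ k → :- (:- k) := k) refl k) (ℚ.neg-antimono-≤ lo))

  ≤∣∣ : ∀ a → a ≤ ∣ a ∣
  ≤∣∣ a with ℚ.≤-total 0ℚ a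
  ... | inj₁ 0≤a = ℚ.≤-reflexive (sym (ℚ.0≤p⇒∣p∣≡p 0≤a))
  ... | inj₂ a≤0 = ℚ.≤-trans a≤0 (ℚ.0≤∣p∣ a)

  -∣∣≤ : ∀ a → - ∣ a ∣ ≤ a
  -∣∣≤ a = subst (- ∣ a ∣ ≤_) (solve 1 (λ a → :- (:- a) := a) refl a)
    (ℚ.neg-antimono-≤ (subst (- a ≤_) (ℚ.∣-p∣≡∣p∣ a) (≤∣∣ (- a))))

  spread : ∀ {a w s s′} → a ≤ s → s ≤ a + w → a ≤ s′ → s′ ≤ a + w → ∣ s - s′ ∣ ≤ w
  spread {a} {w} {s} {s′} a≤s s≤a+w a≤s′ s′≤a+w = abs-≤
    (subst (_≤ s - s′) (solve 2 (λ a w → a :- (a :+ w) := :- w) refl a w)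
      (ℚ.+-mono-≤ a≤s (ℚ.neg-antimono-≤ s′≤a+w)))
    (subst (s - s′ ≤_) (solve 2 (λ a w → a :+ w :- a := w) refl a w)
      (ℚ.+-mono-≤ s≤a+w (ℚ.neg-antimono-≤ a≤s′)))

  ÷-small : ∀ {K M ε} → 0ℚ < K → 0ℚ < M → 0ℚ < ε →
    ∃ λ w → 0ℚ < w × w ≤ 1ℚ × w * M + K * w ≤ ε
  ÷-small {K} {M} {ε} 0<K 0<M 0<ε with ÷-* ε {K + M + ε} (ℚ.+-mono-< (ℚ.+-mono-< 0<K 0<M) 0<ε)
  ... | w , w*≡ε , pos⇒ = w , 0<w ,
    ℚ.*-cancelʳ-≤-pos D {{positive 0<D}} (≤-by (K + M) (ℚ.<⇒≤ (ℚ.+-mono-< 0<K 0<M))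
      (trans (cong (_+ (K + M)) w*≡ε)
        (solve 3 (λ K M e → e :+ (K :+ M) := con 1ℚ :* (K :+ M :+ e)) refl K M ε))) ,
    ≤-by (w * ε) (ℚ.<⇒≤ (0<* 0<w 0<ε))
      (trans (solve 4 (λ w K M e → w :* M :+ K :* w :+ w :* e := w :* (K :+ M :+ e)) refl w K M ε) w*≡ε)
    where
    D = K + M + ε
    0<D = ℚ.+-mono-< (ℚ.+-mono-< 0<K 0<M) 0<ε
    0<w = pos⇒ 0<ε

  product-variation : ∀ {s t s′ t′ v w K M ε} → ∣ s - s′ ∣ ≤ v → ∣ t - t′ ∣ ≤ w →
    ∣ s′ ∣ ≤ K → ∣ t ∣ ≤ M → v * M + K * w ≤ ε → s * t ≤ s′ * t′ + ε
  product-variation {s} {t} {s′} {t′} ds dt s′≤K t≤M ≤ε =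
    subst (_≤ s′ * t′ + _)
      (solve 4 (λ s t s′ t′ → s′ :* t′ :+ ((s :- s′) :* t :+ s′ :* (t :- t′)) := s :* t) refl s t s′ t′)
      (ℚ.+-monoʳ-≤ (s′ * t′) (ℚ.≤-trans (ℚ.+-mono-≤ (bound ds t≤M) (bound s′≤K dt)) ≤ε))
    where
    bound : ∀ {x y a b} → ∣ x ∣ ≤ a → ∣ y ∣ ≤ b → x * y ≤ a * b
    bound {x} {y} x≤a y≤b = ℚ.≤-trans (≤∣∣ (x * y))
      (subst (_≤ _) (sym (ℚ.∣p*q∣≡∣p∣*∣q∣ x y))
        (*-mono-≤ (ℚ.0≤∣p∣ x) x≤a (ℚ.0≤∣p∣ y) y≤b))

  -- Comparison and addition of fractions, via unnormalised rationals.

  /-mono-≤ : ∀ i j m n → i ℤ.* + suc n ℤ.≤ j ℤ.* + suc m → i / suc m ≤ j / suc n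
  /-mono-≤ i j m n p = ℚ.toℚᵘ-cancel-≤
    (ℚᵘ.≤-respˡ-≃ (ℚᵘ.≃-sym (ℚ.toℚᵘ-fromℚᵘ (mkℚᵘ i m)))
    (ℚᵘ.≤-respʳ-≃ (ℚᵘ.≃-sym (ℚ.toℚᵘ-fromℚᵘ (mkℚᵘ j n))) (ℚᵘ.*≤* p)))

  /-cancel-< : ∀ i j m n → i / suc m < j / suc n → i ℤ.* + suc n ℤ.< j ℤ.* + suc m
  /-cancel-< i j m n p = ℚᵘ.drop-*<*
    (ℚᵘ.<-respˡ-≃ (ℚ.toℚᵘ-fromℚᵘ (mkℚᵘ i m))
    (ℚᵘ.<-respʳ-≃ (ℚ.toℚᵘ-fromℚᵘ (mkℚᵘ j n)) (ℚ.toℚᵘ-mono-< p)))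

  ℕ⇒ℚ-mono-≤ : ∀ {m n} → m ℕ.≤ n → ℕ⇒ℚ m ≤ ℕ⇒ℚ n
  ℕ⇒ℚ-mono-≤ m≤n = *≤* (ℤ.*-monoʳ-≤-nonNeg (+ 1) (ℤ.+≤+ m≤n))

  0≤ℕ⇒ℚ : ∀ n → 0ℚ ≤ ℕ⇒ℚ n
  0≤ℕ⇒ℚ n = ℕ⇒ℚ-mono-≤ {0} {n} ℕ.z≤n

  ℕ⇒ℚ-suc : ∀ n → ℕ⇒ℚ (suc n) ≡ 1ℚ + ℕ⇒ℚ n
  ℕ⇒ℚ-suc n = ℚ.toℚᵘ-injective (ℚᵘ.≃-sym (ℚᵘ.≃-trans (ℚ.toℚᵘ-homo-+ 1ℚ (ℕ⇒ℚ n))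
    (ℚᵘ.*≡* (cong (ℤ._* + 1) (cong (λ z → + 1 ℤ.+ z) (ℤ.*-identityʳ (+ n)))))))

  /-suc : ∀ k n → + suc k / suc n ≡ + 1 / suc n + ℕ⇒ℚ k * (+ 1 / suc n)
  /-suc k n = trans (times (suc k)) (trans (cong (_* u) (ℕ⇒ℚ-suc k))
    (solve 2 (λ u k → (con 1ℚ :+ k) :* u := u :+ k :* u) refl u (ℕ⇒ℚ k)))
    where
    u = + 1 / suc n
    times : ∀ k → + k / suc n ≡ ℕ⇒ℚ k * u
    times k = ℚ.toℚᵘ-injective (ℚᵘ.≃-trans (ℚ.toℚᵘ-fromℚᵘ (mkℚᵘ (+ k) n))
      (ℚᵘ.≃-sym (ℚᵘ.≃-trans (ℚ.toℚᵘ-homo-* (ℕ⇒ℚ k) u)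
      (ℚᵘ.≃-trans (ℚᵘ.*-congˡ {mkℚᵘ (+ k) 0} (ℚ.toℚᵘ-fromℚᵘ (mkℚᵘ (+ 1) n)))
        (ℚᵘ.*≡* (trans (cong (ℤ._* + suc n) (ℤ.*-identityʳ (+ k)))
          (cong (λ z → + k ℤ.* + suc z) (sym (ℕ.+-identityʳ n)))))))))

  step₀ : ∀ a s → a ≡ a + 0ℚ * s
  step₀ = solve 2 (λ a s → a := a :+ con 0ℚ :* s) refl

  step₁ : ∀ a s {K K′} → K′ ≡ 1ℚ + K → a + K * s + s ≡ a + K′ * s
  step₁ a s {K} refl = solve 3 (λ a K s → a :+ K :* s :+ s := a :+ (con 1ℚ :+ K) :* s) refl a K s

  step₂ : ∀ a {s e K K′ K″} → s + s ≡ e → K′ ≡ 1ℚ + K → K″ ≡ 1ℚ + K′ → a + K″ * s ≡ a + K * s + e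
  step₂ a {s} {_} {K} refl refl refl =
    solve 3 (λ a K s → a :+ (con 1ℚ :+ (con 1ℚ :+ K)) :* s := a :+ K :* s :+ (s :+ s)) refl a K s

  +-− : ∀ a b → a + (b - a) ≡ b
  +-− = solve 2 (λ a b → a :+ (b :- a) := b) refl

  +-cancel-≤ : ∀ {a b} e → a + e ≤ b + e → a ≤ b
  +-cancel-≤ {a} {b} e p = subst₂ _≤_ (+-−-cancel a e) (+-−-cancel b e) (ℚ.+-monoˡ-≤ (- e) p)
    where
    +-−-cancel : ∀ a e → a + e - e ≡ a
    +-−-cancel = solve 2 (λ a e → a :+ e :- e := a) refl

  ≤+⇒-≤ : ∀ {a b e} → a ≤ b + e → a - e ≤ b
  ≤+⇒-≤ {a} {b} {e} p = +-cancel-≤ e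
    (subst (_≤ b + e) (solve 2 (λ a e → a := a :- e :+ e) refl a e) p)

  sum-bound : ∀ {p q a c e} → e + e ≡ q - p → a + c ≤ p → (a + e) + (c + e) ≤ q
  sum-bound {p} {q} {a} {c} {e} eq a+c≤p = subst₂ _≤_
    (solve 3 (λ a c e → a :+ c :+ (e :+ e) := a :+ e :+ (c :+ e)) refl a c e)
    (trans (cong (λ z → p + z) eq) (+-− p q))
    (ℚ.+-monoˡ-≤ (e + e) a+c≤p)

  sum-bound′ : ∀ {p q a e} → e + e ≡ q - p → a ≤ p + e → a + e ≤ q
  sum-bound′ {p} {q} {a} {e} eq a≤p+e = subst (a + e ≤_)
    (trans (ℚ.+-assoc p e e) (trans (cong (λ z → p + z) eq) (+-− p q)))
    (ℚ.+-monoˡ-≤ e a≤p+e)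

  positive-fraction : ∀ {r} → 0ℚ < r → ∃₂ λ m n → r ≡ + suc m / suc n
  positive-fraction {r@(mkℚ (+ zero)  _ _)} (*<* (ℤ.+<+ ()))
  positive-fraction {r@(mkℚ +[1+ m ] n _)} _ = m , n , sym (ℚ.↥p/↧p≡p r)
  positive-fraction {r@(mkℚ -[1+ m ] n _)} (*<* ())

  archimedean : ∀ x {e} → 0ℚ < e → ∃ λ n → x ≤ ℕ⇒ℚ n * e
  archimedean x {e} 0<e with ÷-* x 0<e
  ... | y , y*e≡x , _ = ℤ.∣ ↥ y ∣ , subst (_≤ ℕ⇒ℚ ℤ.∣ ↥ y ∣ * e) y*e≡x
      (ℚ.*-monoʳ-≤-nonNeg e {{nonNegative (ℚ.<⇒≤ 0<e)}} (bound y))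
    where
    bound : ∀ y → y ≤ ℕ⇒ℚ ℤ.∣ ↥ y ∣
    bound (mkℚ (+ n)    d _) = *≤* (ℤ.*-monoˡ-≤-nonNeg (+ n) (ℤ.+≤+ (ℕ.s≤s ℕ.z≤n)))
    bound (mkℚ -[1+ n ] d _) = *≤* ℤ.-≤+

  -- Powers.

  ^-0≤ : ∀ {a} n → 0ℚ ≤ a → 0ℚ ≤ a ^ℚ n
  ^-0≤ zero    0≤a = ℚ.nonNegative⁻¹ 1ℚ
  ^-0≤ (suc n) 0≤a = 0≤* 0≤a (^-0≤ n 0≤a)

  ^-0< : ∀ {a} n → 0ℚ < a → 0ℚ < a ^ℚ n
  ^-0< zero    0<a = ℚ.positive⁻¹ 1ℚ
  ^-0< (suc n) 0<a = 0<* 0<a (^-0< n 0<a)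

  ^-mono-≤ : ∀ {a b} n → 0ℚ ≤ a → a ≤ b → a ^ℚ n ≤ b ^ℚ n
  ^-mono-≤ zero    0≤a a≤b = ℚ.≤-refl
  ^-mono-≤ (suc n) 0≤a a≤b = *-mono-≤ 0≤a a≤b (^-0≤ n 0≤a) (^-mono-≤ n 0≤a a≤b)

  ^-mono-< : ∀ {a b} n → 0ℚ ≤ a → a < b → a ^ℚ suc n < b ^ℚ suc n
  ^-mono-< {a} {b} n 0≤a a<b = ℚ.≤-<-trans
    (ℚ.*-monoˡ-≤-nonNeg a {{nonNegative 0≤a}} (^-mono-≤ n 0≤a (ℚ.<⇒≤ a<b)))
    (ℚ.*-monoˡ-<-pos (b ^ℚ n) {{positive (^-0< n (ℚ.≤-<-trans 0≤a a<b))}} a<b)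

  ^-cancel-≤ : ∀ {a b} n → 0ℚ ≤ b → a ^ℚ suc n ≤ b ^ℚ suc n → a ≤ b
  ^-cancel-≤ {a} {b} n 0≤b p with a ℚ.≤? b
  ... | yes a≤b = a≤b
  ... | no  a≰b = ⊥-elim (ℚ.<⇒≢ (ℚ.<-≤-trans (^-mono-< n 0≤b (ℚ.≰⇒> a≰b)) p) refl)

  1≤^ : ∀ {x} j → 1ℚ ≤ x → 1ℚ ≤ x ^ℚ j
  1≤^ zero    1≤x = ℚ.≤-refl
  1≤^ (suc j) 1≤x = *-mono-≤ (ℚ.nonNegative⁻¹ 1ℚ) 1≤x (ℚ.nonNegative⁻¹ 1ℚ) (1≤^ j 1≤x)

  ^-monoʳ-≤ : ∀ {x i j} → 1ℚ ≤ x → i ℕ.≤ j → x ^ℚ i ≤ x ^ℚ j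
  ^-monoʳ-≤ {j = j} 1≤x ℕ.z≤n = 1≤^ j 1≤x
  ^-monoʳ-≤ {x} 1≤x (ℕ.s≤s p) = ℚ.*-monoˡ-≤-nonNeg x
    {{nonNegative (ℚ.≤-trans (ℚ.nonNegative⁻¹ 1ℚ) 1≤x)}} (^-monoʳ-≤ 1≤x p)

  ^-monoʳ-≤₀ : ∀ {x i j} → x ≡ 0ℚ ⊎ 1ℚ ≤ x → i ℕ.≤ j → x ^ℚ suc i ≤ x ^ℚ suc j
  ^-monoʳ-≤₀ {_} {i} {j} (inj₁ refl) _ = ℚ.≤-reflexive
    (trans (ℚ.*-zeroˡ (0ℚ ^ℚ i)) (sym (ℚ.*-zeroˡ (0ℚ ^ℚ j))))
  ^-monoʳ-≤₀ (inj₂ 1≤x) i≤j = ^-monoʳ-≤ 1≤x (ℕ.s≤s i≤j)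

  0or1≤ : ∀ N → ℕ⇒ℚ N ≡ 0ℚ ⊎ 1ℚ ≤ ℕ⇒ℚ N
  0or1≤ zero    = inj₁ refl
  0or1≤ (suc N) = inj₂ (ℕ⇒ℚ-mono-≤ {1} {suc N} (ℕ.s≤s ℕ.z≤n))

  -- Bernoulli's inequality, multiplied by q ^ suc k.
  bernoulli : ∀ {q e} k → 0ℚ ≤ q → 0ℚ ≤ e → q ^ℚ k * (q + ℕ⇒ℚ k * e) ≤ q * (q + e) ^ℚ k
  bernoulli {q} {e} zero 0≤q 0≤e = ℚ.≤-reflexive
    (solve 2 (λ q e → con 1ℚ :* (q :+ con 0ℚ :* e) := q :* con 1ℚ) refl q e)
  bernoulli {q} {e} (suc k) 0≤q 0≤e = ℚ.≤-trans
    (≤-by (Q * (K * (e * e))) (0≤* (^-0≤ k 0≤q) (0≤* (0≤ℕ⇒ℚ k) (0≤* 0≤e 0≤e)))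
      (trans (cong (λ z → q * Q * (q + z * e) + Q * (K * (e * e))) (ℕ⇒ℚ-suc k))
        (solve 4 (λ q e K Q → q :* Q :* (q :+ (con 1ℚ :+ K) :* e) :+ Q :* (K :* (e :* e))
                           := (q :+ e) :* (Q :* (q :+ K :* e))) refl q e K Q)))
    (subst ((q + e) * (Q * (q + K * e)) ≤_)
      (solve 3 (λ q e R → (q :+ e) :* (q :* R) := q :* ((q :+ e) :* R)) refl q e ((q + e) ^ℚ k))
      (ℚ.*-monoˡ-≤-nonNeg (q + e) {{nonNegative (0≤+ 0≤q 0≤e)}} (bernoulli k 0≤q 0≤e)))
    where
    K = ℕ⇒ℚ k
    Q = q ^ℚ k

  power-gap : ∀ {q q′} M → 0ℚ < q → q < q′ → ∃ λ k → q ^ℚ suc k * M ≤ q′ ^ℚ suc k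
  power-gap {q} {q′} M 0<q q<q′ with archimedean (M * q) (<⇒0<- q<q′)
  ... | k , Mq≤ke = k , ℚ.*-cancelˡ-≤-pos q {{positive 0<q}}
      (ℚ.≤-trans (subst (_≤ Q * (q + ℕ⇒ℚ (suc k) * e))
                   (solve 3 (λ q Q M → Q :* (M :* q) := q :* (Q :* M)) refl q Q M)
                   (ℚ.*-monoˡ-≤-nonNeg Q {{nonNegative (^-0≤ (suc k) 0≤q)}} bound))
        (subst (λ z → Q * (q + ℕ⇒ℚ (suc k) * e) ≤ q * z ^ℚ suc k) q+e≡q′
          (bernoulli (suc k) 0≤q 0≤e)))
    where
    e = q′ - q
    Q = q ^ℚ suc k
    0≤q = ℚ.<⇒≤ 0<q
    0≤e = ℚ.<⇒≤ (<⇒0<- q<q′)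
    q+e≡q′ : q + e ≡ q′
    q+e≡q′ = solve 2 (λ q q′ → q :+ (q′ :- q) := q′) refl q q′
    bound : M * q ≤ q + ℕ⇒ℚ (suc k) * e
    bound = ℚ.≤-trans Mq≤ke (≤-by (q + e) (0≤+ 0≤q 0≤e)
      (trans (solve 3 (λ q e k → k :* e :+ (q :+ e) := q :+ (con 1ℚ :+ k) :* e) refl q e (ℕ⇒ℚ k))
        (cong (λ z → q + z * e) (sym (ℕ⇒ℚ-suc k)))))

  ^-*-assoc : ∀ x m n → (x ^ℚ m) ^ℚ n ≡ x ^ℚ (m ℕ.* n)
  ^-*-assoc = E.^-assocʳ

  ^-distrib-* : ∀ x y n → (x * y) ^ℚ n ≡ x ^ℚ n * y ^ℚ n
  ^-distrib-* = E.^-distrib-*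

  x≤[x+1]² : ∀ {x} → 0ℚ ≤ x → x ≤ (x + 1ℚ) ^ℚ 2
  x≤[x+1]² {x} 0≤x = ≤-by (x * x + x + 1ℚ) (0≤+ (0≤+ (0≤* 0≤x 0≤x) 0≤x) (ℚ.nonNegative⁻¹ 1ℚ))
    (solve 1 (λ x → x :+ (x :* x :+ x :+ con 1ℚ) := (x :+ con 1ℚ) :* ((x :+ con 1ℚ) :* con 1ℚ)) refl x)

  root-bound : ∀ {x} n → 0ℚ ≤ x → ∃ λ q → 0ℚ ≤ q × x ≤ q ^ℚ suc n
  root-bound {x} n 0≤x = x + 1ℚ , 0≤+ 0≤x (ℚ.nonNegative⁻¹ 1ℚ) ,
    ℚ.≤-trans (≤-by 1ℚ (ℚ.nonNegative⁻¹ 1ℚ) refl)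
      (subst (_≤ (x + 1ℚ) ^ℚ suc n) (ℚ.*-identityʳ (x + 1ℚ))
        (^-monoʳ-≤ {x + 1ℚ} {1} {suc n} 1≤ (ℕ.s≤s ℕ.z≤n)))
    where
    1≤ : 1ℚ ≤ x + 1ℚ
    1≤ = ≤-by x 0≤x (ℚ.+-comm 1ℚ x)

  /-cancel-<ℕ : ∀ m n m′ n′ → + suc m / suc n < + suc m′ / suc n′ →
    suc m ℕ.* suc n′ ℕ.< suc m′ ℕ.* suc n
  /-cancel-<ℕ m n m′ n′ p = ℤ.drop‿+<+ (/-cancel-< (+ suc m) (+ suc m′) n n′ p)

  compare-roots : ∀ m n m′ n′ {x a b} → 0ℚ ≤ x → x ≡ 0ℚ ⊎ 1ℚ ≤ x → 0ℚ ≤ b →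
    suc m ℕ.* suc n′ ℕ.< suc m′ ℕ.* suc n →
    a ^ℚ suc n ≤ x ^ℚ suc m → x ^ℚ suc m′ ≤ b ^ℚ suc n′ → a ≤ b
  compare-roots m n m′ n′ {x} {a} {b} 0≤x x01 0≤b lt a≤ ≤b with ℚ.≤-total a 0ℚ
  ... | inj₁ a≤0 = ℚ.≤-trans a≤0 0≤b
  ... | inj₂ 0≤a = ^-cancel-≤ (n′ ℕ.+ n ℕ.* suc n′) 0≤b (begin
    a ^ℚ (suc n ℕ.* suc n′)     ≡⟨ ^-*-assoc a (suc n) (suc n′) ⟨
    (a ^ℚ suc n) ^ℚ suc n′      ≤⟨ ^-mono-≤ (suc n′) (^-0≤ (suc n) 0≤a) a≤ ⟩
    (x ^ℚ suc m) ^ℚ suc n′      ≡⟨ ^-*-assoc x (suc m) (suc n′) ⟩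
    x ^ℚ (suc m ℕ.* suc n′)     ≤⟨ ^-monoʳ-≤₀ x01 (ℕ.≤-pred (ℕ.<⇒≤ lt)) ⟩
    x ^ℚ (suc m′ ℕ.* suc n)     ≡⟨ ^-*-assoc x (suc m′) (suc n) ⟨
    (x ^ℚ suc m′) ^ℚ suc n      ≤⟨ ^-mono-≤ (suc n) (^-0≤ (suc m′) 0≤x) ≤b ⟩
    (b ^ℚ suc n′) ^ℚ suc n      ≡⟨ ^-*-assoc b (suc n′) (suc n) ⟩
    b ^ℚ (suc n′ ℕ.* suc n)     ≡⟨ cong (b ^ℚ_) (ℕ.*-comm (suc n′) (suc n)) ⟩
    b ^ℚ (suc n ℕ.* suc n′)     ∎)
    where open ℚ.≤-Reasoning

  0<1/suc : ∀ n → 0ℚ < + 1 / suc n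
  0<1/suc n = ℚ.positive⁻¹ (+ 1 / suc n) {{ℚ.normalize-pos 1 (suc n)}}

  1/-antimono : ∀ m d k → + 1 / (suc k ℕ.* suc d) ≤ + suc m / suc d
  1/-antimono m d k = /-mono-≤ (+ 1) (+ suc m) (d ℕ.+ k ℕ.* suc d) d (ℤ.+≤+
    (ℕ.≤-trans (ℕ.≤-reflexive (ℕ.*-identityˡ (suc d)))
    (ℕ.≤-trans (ℕ.m≤m+n (suc d) (k ℕ.* suc d)) (ℕ.m≤n*m (suc k ℕ.* suc d) (suc m)))))

  jump : ∀ k d j {x p q} → 0ℚ ≤ x → x ≡ 0ℚ ⊎ 1ℚ ≤ x → 0ℚ ≤ p →
    p ^ℚ suc k * x ^ℚ 2 ≤ q ^ℚ suc k → x ^ℚ suc j ≤ p ^ℚ (suc k ℕ.* suc d) →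
    x ^ℚ (3 ℕ.+ j) ≤ q ^ℚ (suc k ℕ.* suc d)
  jump k d j {x} {p} {q} 0≤x x01 0≤p gap x≤p = begin
    x ^ℚ (3 ℕ.+ j)                                  ≡⟨ pull x (x ^ℚ suc j) ⟩
    x ^ℚ suc j * x ^ℚ 2                             ≤⟨ *-mono-≤ (^-0≤ (suc j) 0≤x) x≤p (^-0≤ 2 0≤x) x²≤ ⟩
    p ^ℚ (suc k ℕ.* suc d) * (x ^ℚ 2) ^ℚ suc d      ≡⟨ cong (_* (x ^ℚ 2) ^ℚ suc d) (^-*-assoc p (suc k) (suc d)) ⟨
    (p ^ℚ suc k) ^ℚ suc d * (x ^ℚ 2) ^ℚ suc d       ≡⟨ ^-distrib-* (p ^ℚ suc k) (x ^ℚ 2) (suc d) ⟨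
    (p ^ℚ suc k * x ^ℚ 2) ^ℚ suc d                  ≤⟨ ^-mono-≤ (suc d) (0≤* (^-0≤ (suc k) 0≤p) (^-0≤ 2 0≤x)) gap ⟩
    (q ^ℚ suc k) ^ℚ suc d                           ≡⟨ ^-*-assoc q (suc k) (suc d) ⟩
    q ^ℚ (suc k ℕ.* suc d)                          ∎
    where
    open ℚ.≤-Reasoning
    pull : ∀ x y → x * (x * y) ≡ y * (x * (x * 1ℚ))
    pull = solve 2 (λ x y → x :* (x :* y) := y :* (x :* (x :* con 1ℚ))) refl
    x²≤ : x ^ℚ 2 ≤ (x ^ℚ 2) ^ℚ suc d
    x²≤ = subst (x ^ℚ 2 ≤_) (sym (^-*-assoc x 2 (suc d))) (^-monoʳ-≤₀ x01
      (ℕ.≤-trans (ℕ.s≤s ℕ.z≤n) (ℕ.≤-reflexive (sym (ℕ.+-suc d (d ℕ.+ 0))))))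

open RationalLemmas

-- Real numbers: two-sided, located Dedekind cuts in ℚ.  L q is read as q < x
-- and U q as x < q.  Classically this is the usual field of real numbers.

record ℝ : Set₁ where
  field
    L U      : ℚ → Set
    L-∃      : ∃ L
    U-∃      : ∃ U
    L-down   : ∀ {p q} → p ℚ.< q → L q → L p
    U-up     : ∀ {p q} → p ℚ.< q → U p → U q
    L-open   : ∀ {p} → L p → ∃ λ q → p ℚ.< q × L q
    U-open   : ∀ {q} → U q → ∃ λ p → p ℚ.< q × U p
    disjoint : ∀ {q} → L q → ¬ U q
    located  : ∀ {p q} → p ℚ.< q → L p ⊎ U q

open ℝ

infix  8 -_
infixl 7 _*_
infixl 6 _+_ _-_
infix  4 _<_ _≤_ _≥_

_<_ : ℝ → ℝ → Set
x < y = ∃ λ q → U x q × L y q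

_≤_ : ℝ → ℝ → Set
x ≤ y = ∀ {q} → L x q → L y q

_≥_ : ℝ → ℝ → Set
x ≥ y = y ≤ x

-- The real number x = sup A = inf B.
cut : (A B : ℚ → Set) → ∃ A → ∃ B → (∀ {a b} → A a → B b → a ℚ.≤ b) →
  (∀ {p q} → p ℚ.< q → A p ⊎ B q) → ℝ
cut A B (a , Aa) (b , Bb) A≤B A⊎B = record
  { L        = λ q → ∃ λ r → q ℚ.< r × A r
  ; U        = λ q → ∃ λ r → r ℚ.< q × B r
  ; L-∃      = a ℚ.- 1ℚ , a , <-by 1ℚ (ℚ.positive⁻¹ 1ℚ)
                 (solve 1 (λ a → a :- con 1ℚ :+ con 1ℚ := a) refl a) , Aa
  ; U-∃      = b ℚ.+ 1ℚ , b , <-by 1ℚ (ℚ.positive⁻¹ 1ℚ) refl , Bb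
  ; L-down   = λ p<q (r , q<r , Ar) → r , ℚ.<-trans p<q q<r , Ar
  ; U-up     = λ p<q (r , r<p , Br) → r , ℚ.<-trans r<p p<q , Br
  ; L-open   = λ (r , p<r , Ar) → let m , p<m , m<r = ℚ.<-dense p<r in m , p<m , r , m<r , Ar
  ; U-open   = λ (r , r<q , Br) → let m , r<m , m<q = ℚ.<-dense r<q in m , m<q , r , r<m , Br
  ; disjoint = λ (r , q<r , Ar) (s , s<q , Bs) →
                 ℚ.<⇒≢ (ℚ.<-≤-trans (ℚ.<-trans s<q q<r) (A≤B Ar Bs)) refl
  ; located  = loc
  }
  where
  open +-*-Solver
  loc : ∀ {p q} → p ℚ.< q → (∃ λ r → p ℚ.< r × A r) ⊎ (∃ λ r → r ℚ.< q × B r)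
  loc p<q with ℚ.<-dense p<q
  ... | m , p<m , m<q with ℚ.<-dense m<q
  ... | n , m<n , n<q with A⊎B m<n
  ... | inj₁ Am = inj₁ (m , p<m , Am)
  ... | inj₂ Bn = inj₂ (n , n<q , Bn)

fromℚ : ℚ → ℝ
fromℚ x = cut (ℚ._≤ x) (x ℚ.≤_) (x , ℚ.≤-refl) (x , ℚ.≤-refl) ℚ.≤-trans split
  where
  split : ∀ {p q} → p ℚ.< q → p ℚ.≤ x ⊎ x ℚ.≤ q
  split {p} p<q with ℚ.≤-total p x
  ... | inj₁ p≤x = inj₁ p≤x
  ... | inj₂ x≤p = inj₂ (ℚ.≤-trans x≤p (ℚ.<⇒≤ p<q))

fromℕ : ℕ → ℝ
fromℕ n = fromℚ (ℕ⇒ℚ n)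

0ℝ : ℝ
0ℝ = fromℚ 0ℚ

module RealLemmas (x : ℝ) where
  open +-*-Solver

  L<U : ∀ {p q} → L x p → U x q → p ℚ.< q
  L<U {p} {q} Lp Uq with ℚ.<-cmp p q
  ... | tri< p<q _ _ = p<q
  ... | tri≈ _ refl _ = ⊥-elim (disjoint x Lp Uq)
  ... | tri> _ _ q<p = ⊥-elim (disjoint x Lp (U-up x q<p Uq))

  U-up-≤ : ∀ {p q} → p ℚ.≤ q → U x p → U x q
  U-up-≤ {p} {q} p≤q Up with ℚ.<-cmp p q
  ... | tri< p<q _ _ = U-up x p<q Up
  ... | tri≈ _ refl _ = Up
  ... | tri> _ _ q<p = ⊥-elim (ℚ.<⇒≢ (ℚ.<-≤-trans q<p p≤q) refl)

  L-down-≤ : ∀ {p q} → p ℚ.≤ q → L x q → L x p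
  L-down-≤ {p} {q} p≤q Lq with ℚ.<-cmp p q
  ... | tri< p<q _ _ = L-down x p<q Lq
  ... | tri≈ _ refl _ = Lq
  ... | tri> _ _ q<p = ⊥-elim (ℚ.<⇒≢ (ℚ.<-≤-trans q<p p≤q) refl)

  -- Walking upwards from a point of L in steps of length s.
  walk : ∀ {a s} → 0ℚ ℚ.< s → L x a →
    ∃ λ k → L x (a ℚ.+ ℕ⇒ℚ k ℚ.* s) × U x (a ℚ.+ ℕ⇒ℚ (2 ℕ.+ k) ℚ.* s)
  walk {a} {s} 0<s La with U-∃ x
  ... | b , Ub with archimedean (b ℚ.- a) 0<s
  ... | n , b-a≤ns = go n 0
      (subst (L x) (step₀ a s) La)
      (subst Uat (sym (ℕ.+-identityʳ n)) (U-up-≤ b≤ Ub))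
    where
    at : ℕ → ℚ
    at k = a ℚ.+ ℕ⇒ℚ k ℚ.* s
    Uat : ℕ → Set
    Uat k = U x (at k)
    b≤ : b ℚ.≤ at n
    b≤ = subst (ℚ._≤ at n) (+-− a b)
      (ℚ.+-monoʳ-≤ a b-a≤ns)
    at-suc : ∀ k → at k ℚ.< at (suc k)
    at-suc k = <-by s 0<s (step₁ a s (ℕ⇒ℚ-suc k))
    go : ∀ n k → L x (at k) → U x (at (n ℕ.+ k)) → ∃ λ k → L x (at k) × U x (at (2 ℕ.+ k))
    go zero    k Lk Uk = ⊥-elim (disjoint x Lk Uk)
    go (suc n) k Lk Un with located x (at-suc (suc k))
    ... | inj₁ L1 = go n (suc k) L1 (subst Uat (sym (ℕ.+-suc n k)) Un)
    ... | inj₂ U2 = k , Lk , U2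

  approximate : ∀ {e} → 0ℚ ℚ.< e → ∃ λ a → L x a × U x (a ℚ.+ e)
  approximate {e} 0<e =
    let a , La = L-∃ x
        s , 0<s , s+s≡e = half 0<e
        k , Lk , U2 = walk 0<s La
    in a ℚ.+ ℕ⇒ℚ k ℚ.* s , Lk ,
       subst (U x) (step₂ a {s} {e} {ℕ⇒ℚ k} {ℕ⇒ℚ (suc k)} {ℕ⇒ℚ (2 ℕ.+ k)}
                     s+s≡e (ℕ⇒ℚ-suc k) (ℕ⇒ℚ-suc (suc k))) U2

  Bounds : ℚ → Set
  Bounds K = ∀ {w a s} → w ℚ.≤ 1ℚ → L x a → U x (a ℚ.+ w) →
    a ℚ.≤ s → s ℚ.≤ a ℚ.+ w → ℚ.∣ s ∣ ℚ.≤ K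

  magnitude : ∃ λ K → 0ℚ ℚ.< K × Bounds K
  magnitude with L-∃ x | U-∃ x
  ... | a₀ , La₀ | b₀ , Ub₀ = K , <-by K (ℚ.+-mono-≤-< 0≤AB (ℚ.positive⁻¹ 1ℚ)) (ℚ.+-identityˡ K) , bound
    where
    A = ℚ.∣ a₀ ∣
    B = ℚ.∣ b₀ ∣
    K = A ℚ.+ B ℚ.+ 1ℚ
    0≤AB : 0ℚ ℚ.≤ A ℚ.+ B
    0≤AB = 0≤+ (ℚ.0≤∣p∣ a₀) (ℚ.0≤∣p∣ b₀)
    bound : ∀ {w a s} → w ℚ.≤ 1ℚ → L x a → U x (a ℚ.+ w) →
      a ℚ.≤ s → s ℚ.≤ a ℚ.+ w → ℚ.∣ s ∣ ℚ.≤ K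
    bound {w} {a} {s} w≤1 La Ua+w a≤s s≤a+w = abs-≤ lo hi
      where
      hi : s ℚ.≤ K
      hi = ℚ.≤-trans s≤a+w (ℚ.≤-trans
        (ℚ.+-mono-≤ (ℚ.≤-trans (ℚ.<⇒≤ (L<U La Ub₀)) (≤∣∣ b₀)) w≤1)
        (≤-by A (ℚ.0≤∣p∣ a₀)
          (solve 2 (λ A B → B :+ con 1ℚ :+ A := A :+ B :+ con 1ℚ) refl A B)))
      lo : ℚ.- K ℚ.≤ s
      lo = ℚ.≤-trans
        (≤-by B (ℚ.0≤∣p∣ b₀)
          (solve 2 (λ A B → :- (A :+ B :+ con 1ℚ) :+ B := :- A :+ :- con 1ℚ) refl A B))
        (ℚ.≤-trans (ℚ.+-mono-≤ (-∣∣≤ a₀) (ℚ.neg-antimono-≤ w≤1))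
        (ℚ.≤-trans (ℚ.+-monoˡ-≤ (ℚ.- w) (ℚ.<⇒≤ (L<U La₀ Ua+w)))
        (ℚ.≤-trans (ℚ.≤-reflexive (solve 2 (λ a w → a :+ w :- w := a) refl a w)) a≤s)))

open RealLemmas

-_ : ℝ → ℝ
- x = record
  { L        = λ q → U x (ℚ.- q)
  ; U        = λ q → L x (ℚ.- q)
  ; L-∃      = let b , Ub = U-∃ x in ℚ.- b , subst (U x) (sym (neg² b)) Ub
  ; U-∃      = let a , La = L-∃ x in ℚ.- a , subst (L x) (sym (neg² a)) La
  ; L-down   = λ p<q → U-up x (ℚ.neg-antimono-< p<q)
  ; U-up     = λ p<q → L-down x (ℚ.neg-antimono-< p<q)
  ; L-open   = λ {p} Up → let q , q<-p , Uq = U-open x Up in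
                 ℚ.- q , subst (ℚ._< ℚ.- q) (neg² p) (ℚ.neg-antimono-< q<-p) ,
                 subst (U x) (sym (neg² q)) Uq
  ; U-open   = λ {p} Lp → let q , -p<q , Lq = L-open x Lp in
                 ℚ.- q , subst (ℚ.- q ℚ.<_) (neg² p) (ℚ.neg-antimono-< -p<q) ,
                 subst (L x) (sym (neg² q)) Lq
  ; disjoint = λ Uq Lq → disjoint x Lq Uq
  ; located  = λ p<q → swap (located x (ℚ.neg-antimono-< p<q))
  }
  where
  open +-*-Solver
  neg² : ∀ q → ℚ.- (ℚ.- q) ≡ q
  neg² = solve 1 (λ q → :- (:- q) := q) refl

_+_ : ℝ → ℝ → ℝ
x + y = cut A B
  (let a , La = L-∃ x ; c , Lc = L-∃ y in a ℚ.+ c , a , c , La , Lc , ℚ.≤-refl)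
  (let b , Ub = U-∃ x ; d , Ud = U-∃ y in b ℚ.+ d , b , d , Ub , Ud , ℚ.≤-refl)
  (λ (a , c , La , Lc , p≤) (b , d , Ub , Ud , ≤q) → ℚ.≤-trans p≤ (ℚ.≤-trans
    (ℚ.+-mono-≤ (ℚ.<⇒≤ (L<U x La Ub)) (ℚ.<⇒≤ (L<U y Lc Ud))) ≤q))
  split
  where
  A B : ℚ → Set
  A q = ∃₂ λ a c → L x a × L y c × q ℚ.≤ a ℚ.+ c
  B q = ∃₂ λ b d → U x b × U y d × b ℚ.+ d ℚ.≤ q
  split : ∀ {p q} → p ℚ.< q → A p ⊎ B q
  split p<q = go (half (<⇒0<- p<q))
    where
    decide : ∀ {p q} a c e → L x a → U x (a ℚ.+ e) → L y c → U y (c ℚ.+ e) →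
      e ℚ.+ e ≡ q ℚ.- p → A p ⊎ B q
    decide {p} {q} a c e La Ub Lc Ud e+e≡ with ℚ.≤-total p (a ℚ.+ c)
    ... | inj₁ p≤ = inj₁ (a , c , La , Lc , p≤)
    ... | inj₂ ≤p = inj₂ (a ℚ.+ e , c ℚ.+ e , Ub , Ud , sum-bound {p} {q} {a} {c} {e} e+e≡ ≤p)
    go : ∀ {p q} → (∃ λ e → 0ℚ ℚ.< e × e ℚ.+ e ≡ q ℚ.- p) → A p ⊎ B q
    go {p} {q} (e , 0<e , e+e≡) =
      let a , La , Ub = approximate x 0<e
          c , Lc , Ud = approximate y 0<e
      in decide {p} {q} a c e La Ub Lc Ud e+e≡

_-_ : ℝ → ℝ → ℝ
x - y = x + (- y)

-- Rational rectangles [a , b] × [c , d] with a < x < b and c < y < d.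
record Box (x y : ℝ) : Set where
  field
    {a b c d} : ℚ
    a<x : L x a
    x<b : U x b
    c<y : L y c
    y<d : U y d

  _∋_,_ : ℚ → ℚ → Set
  _∋_,_ s t = (a ℚ.≤ s × s ℚ.≤ b) × (c ℚ.≤ t × t ℚ.≤ d)

-- x * y lies between p and q iff s * t does for all (s , t) in some rectangle
-- around (x , y).
_*_ : ℝ → ℝ → ℝ
x * y = cut A B A-∃ B-∃ A≤B split
  where
  open Box
  A B : ℚ → Set
  A q = ∃ λ (R : Box x y) → ∀ {s t} → R ∋ s , t → q ℚ.≤ s ℚ.* t
  B q = ∃ λ (R : Box x y) → ∀ {s t} → R ∋ s , t → s ℚ.* t ℚ.≤ q

  A≤B : ∀ {p q} → A p → B q → p ℚ.≤ q
  A≤B (R , p≤) (R′ , ≤q) = ℚ.≤-trans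
    (p≤ ((ℚ.p≤p⊔q (a R) (a R′) , ℚ.⊔-lub (<R (a<x R) (x<b R)) (<R (a<x R′) (x<b R))) ,
         (ℚ.p≤p⊔q (c R) (c R′) , ℚ.⊔-lub (<T (c<y R) (y<d R)) (<T (c<y R′) (y<d R)))))
    (≤q ((ℚ.p≤q⊔p (a R) (a R′) , ℚ.⊔-lub (<R (a<x R) (x<b R′)) (<R (a<x R′) (x<b R′))) ,
         (ℚ.p≤q⊔p (c R) (c R′) , ℚ.⊔-lub (<T (c<y R) (y<d R′)) (<T (c<y R′) (y<d R′)))))
    where
    <R : ∀ {p q} → L x p → U x q → p ℚ.≤ q
    <R Lp Uq = ℚ.<⇒≤ (L<U x Lp Uq)
    <T : ∀ {p q} → L y p → U y q → p ℚ.≤ q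
    <T Lp Uq = ℚ.<⇒≤ (L<U y Lp Uq)

  corner : ∀ R → R ∋ a R , c R
  corner R = (ℚ.≤-refl , ℚ.<⇒≤ (L<U x (a<x R) (x<b R))) ,
             (ℚ.≤-refl , ℚ.<⇒≤ (L<U y (c<y R) (y<d R)))

  Oscillates : ℚ → Box x y → Set
  Oscillates ε R = ∀ {s t s′ t′} → R ∋ s , t → R ∋ s′ , t′ → s ℚ.* t ℚ.≤ s′ ℚ.* t′ ℚ.+ ε

  small : ∀ {ε} → 0ℚ ℚ.< ε → ∃ (Oscillates ε)
  small {ε} 0<ε =
    let K , 0<K , x≤K = magnitude x
        M , 0<M , y≤M = magnitude y
    in go K M x≤K y≤M (÷-small 0<K 0<M 0<ε)
    where
    go : ∀ K M → Bounds x K → Bounds y M →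
      (∃ λ w → 0ℚ ℚ.< w × w ℚ.≤ 1ℚ × w ℚ.* M ℚ.+ K ℚ.* w ℚ.≤ ε) → ∃ (Oscillates ε)
    go K M x≤K y≤M (w , 0<w , w≤1 , wM+Kw≤ε) = box (approximate x 0<w) (approximate y 0<w)
      where
      box : (∃ λ a → L x a × U x (a ℚ.+ w)) → (∃ λ c → L y c × U y (c ℚ.+ w)) → ∃ (Oscillates ε)
      box (_ , a<x , x<b) (_ , c<y , y<d) =
        record { a<x = a<x ; x<b = x<b ; c<y = c<y ; y<d = y<d } ,
        λ {s} {t} {s′} {t′} ((a≤s , s≤b) , (c≤t , t≤d)) ((a≤s′ , s′≤b) , (c≤t′ , t′≤d)) →
          product-variation {s} {t} {s′} {t′} {w} {w} {K} {M} {ε}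
            (spread a≤s s≤b a≤s′ s′≤b) (spread c≤t t≤d c≤t′ t′≤d)
            (x≤K w≤1 a<x x<b a≤s′ s′≤b) (y≤M w≤1 c<y y<d c≤t t≤d) wM+Kw≤ε

  A-∃ : ∃ A
  A-∃ = go (small (ℚ.positive⁻¹ 1ℚ))
    where
    go : ∃ (Oscillates 1ℚ) → ∃ A
    go (R , osc) = a R ℚ.* c R ℚ.- 1ℚ , R , λ st → ≤+⇒-≤ (osc (corner R) st)

  B-∃ : ∃ B
  B-∃ = go (small (ℚ.positive⁻¹ 1ℚ))
    where
    go : ∃ (Oscillates 1ℚ) → ∃ B
    go (R , osc) = a R ℚ.* c R ℚ.+ 1ℚ , R , λ st → osc st (corner R)

  split : ∀ {p q} → p ℚ.< q → A p ⊎ B q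
  split p<q = go (half (<⇒0<- p<q))
    where
    decide : ∀ {p q ε} → ε ℚ.+ ε ≡ q ℚ.- p → ∃ (Oscillates ε) → A p ⊎ B q
    decide {p} {q} {ε} ε+ε≡ (R , osc) with ℚ.≤-total (p ℚ.+ ε) (a R ℚ.* c R)
    ... | inj₁ p+ε≤ = inj₁ (R , λ st → +-cancel-≤ ε (ℚ.≤-trans p+ε≤ (osc (corner R) st)))
    ... | inj₂ ≤p+ε = inj₂ (R , λ st → ℚ.≤-trans (osc st (corner R)) (sum-bound′ {p} {q} ε+ε≡ ≤p+ε))
    go : ∀ {p q} → (∃ λ ε → 0ℚ ℚ.< ε × ε ℚ.+ ε ≡ q ℚ.- p) → A p ⊎ B q
    go (ε , 0<ε , ε+ε≡) = decide ε+ε≡ (small 0<ε)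

infix 8 √_

√_ : ℕ → ℝ
√ N = cut A B (0ℚ , inj₁ ℚ.≤-refl) (ℕ⇒ℚ N ℚ.+ 1ℚ , big (0≤ℕ⇒ℚ N)) A≤B split
  where
  A B : ℚ → Set
  A q = q ℚ.≤ 0ℚ ⊎ q ^ℚ 2 ℚ.≤ ℕ⇒ℚ N
  B q = 0ℚ ℚ.≤ q × ℕ⇒ℚ N ℚ.≤ q ^ℚ 2
  big : ∀ {x} → 0ℚ ℚ.≤ x → 0ℚ ℚ.≤ x ℚ.+ 1ℚ × x ℚ.≤ (x ℚ.+ 1ℚ) ^ℚ 2
  big 0≤x = 0≤+ 0≤x (ℚ.nonNegative⁻¹ 1ℚ) , x≤[x+1]² 0≤x
  A≤B : ∀ {a b} → A a → B b → a ℚ.≤ b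
  A≤B (inj₁ a≤0)  (0≤b , _)    = ℚ.≤-trans a≤0 0≤b
  A≤B (inj₂ a²≤N) (0≤b , N≤b²) = ^-cancel-≤ 1 0≤b (ℚ.≤-trans a²≤N N≤b²)
  split : ∀ {p q} → p ℚ.< q → A p ⊎ B q
  split {p} {q} p<q with ℚ.≤-total p 0ℚ | ℚ.≤-total (p ^ℚ 2) (ℕ⇒ℚ N)
  ... | inj₁ p≤0 | _         = inj₁ (inj₁ p≤0)
  ... | inj₂ _   | inj₁ p²≤N = inj₁ (inj₂ p²≤N)
  ... | inj₂ 0≤p | inj₂ N≤p² = inj₂
    (ℚ.≤-trans 0≤p (ℚ.<⇒≤ p<q) , ℚ.≤-trans N≤p² (^-mono-≤ 2 0≤p (ℚ.<⇒≤ p<q)))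

-- q ≤ N ^ (m / n) and N ^ (m / n) ≤ q, for positive integers m and n.

infix 4 _≤_^[_/_] _≥_^[_/_]

_≤_^[_/_] : ℚ → ℕ → ℕ → ℕ → Set
q ≤ N ^[ m / n ] = q ℚ.≤ 0ℚ ⊎ q ^ℚ n ℚ.≤ ℕ⇒ℚ N ^ℚ m

_≥_^[_/_] : ℚ → ℕ → ℕ → ℕ → Set
q ≥ N ^[ m / n ] = 0ℚ ℚ.≤ q × ℕ⇒ℚ N ^ℚ m ℚ.≤ q ^ℚ n

-- N ^ δ for δ > 0, as the supremum of N ^ r over the positive rationals r < δ
-- and the infimum of N ^ r over the rationals r > δ.  In particular 0 ^ δ = 0.
pow : ℕ → (δ : ℝ) → 0ℝ < δ → ℝ
pow N δ 0<δ = cut A B A-∃ B-∃ A≤B split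
  where
  A B : ℚ → Set
  A q = ∃₂ λ m n → L δ (+ suc m ℚ./ suc n) × q ≤ N ^[ suc m / suc n ]
  B q = ∃₂ λ m n → U δ (+ suc m ℚ./ suc n) × q ≥ N ^[ suc m / suc n ]

  fraction-below : ∃₂ λ m n → L δ (+ suc m ℚ./ suc n)
  fraction-below =
    let r , (_ , s<r , 0≤s) , r<δ = 0<δ
        m , n , r≡m/n = positive-fraction (ℚ.≤-<-trans 0≤s s<r)
    in m , n , subst (L δ) r≡m/n r<δ

  fraction-above : ∃₂ λ m n → U δ (+ suc m ℚ./ suc n)
  fraction-above =
    let r , (_ , s<r , 0≤s) , r<δ = 0<δ
        u , δ<u = U-∃ δ
        m , n , u≡m/n = positive-fraction (ℚ.<-trans (ℚ.≤-<-trans 0≤s s<r) (L<U δ r<δ δ<u))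
    in m , n , subst (U δ) u≡m/n δ<u

  A-∃ : ∃ A
  A-∃ = let m , n , m/n<δ = fraction-below in 0ℚ , m , n , m/n<δ , inj₁ ℚ.≤-refl

  B-∃ : ∃ B
  B-∃ = let m , n , δ<m/n = fraction-above
            q , 0≤q , N^m≤q^n = root-bound n (^-0≤ (suc m) (0≤ℕ⇒ℚ N))
        in q , m , n , δ<m/n , 0≤q , N^m≤q^n

  A≤B : ∀ {a b} → A a → B b → a ℚ.≤ b
  A≤B (_ , _ , _ , inj₁ a≤0) (_ , _ , _ , 0≤b , _) = ℚ.≤-trans a≤0 0≤b
  A≤B (m , n , m/n<δ , inj₂ a^n≤N^m) (m′ , n′ , δ<m′/n′ , 0≤b , N^m′≤b^n′) =
    compare-roots m n m′ n′ (0≤ℕ⇒ℚ N) (0or1≤ N) 0≤b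
      (/-cancel-<ℕ m n m′ n′ (L<U δ m/n<δ δ<m′/n′)) a^n≤N^m N^m′≤b^n′

  split : ∀ {p q} → p ℚ.< q → A p ⊎ B q
  split {p} {q} p<q with p ℚ.≤? 0ℚ
  ... | yes p≤0 = let m , n , m/n<δ = fraction-below in inj₁ (m , n , m/n<δ , inj₁ p≤0)
  ... | no  p≰0 = near (power-gap (ℕ⇒ℚ N ^ℚ 2) 0<p p<q) fraction-below
    where
    0<p = ℚ.≰⇒> p≰0

    -- If p ^ K * N² ≤ q ^ K and d is large, there are m / n < δ < (m + 2) / n
    -- with n = K * d, and p ^ n ≥ N ^ m implies q ^ n ≥ N ^ (m + 2).
    near : (∃ λ k → p ^ℚ suc k ℚ.* ℕ⇒ℚ N ^ℚ 2 ℚ.≤ q ^ℚ suc k) →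
      (∃₂ λ m n → L δ (+ suc m ℚ./ suc n)) → A p ⊎ B q
    near (k , gap) (m , d , m/d<δ) = decide (walk δ (0<1/suc n) (L-down-≤ δ (1/-antimono m d k) m/d<δ))
      where
      n = d ℕ.+ k ℕ.* suc d
      decide : (∃ λ j → L δ (+ 1 ℚ./ suc n ℚ.+ ℕ⇒ℚ j ℚ.* (+ 1 ℚ./ suc n)) ×
                        U δ (+ 1 ℚ./ suc n ℚ.+ ℕ⇒ℚ (2 ℕ.+ j) ℚ.* (+ 1 ℚ./ suc n))) → A p ⊎ B q
      decide (j , Lj , Uj) with ℚ.≤-total (p ^ℚ suc n) (ℕ⇒ℚ N ^ℚ suc j)
      ... | inj₁ p^n≤ = inj₁ (j , n , subst (L δ) (sym (/-suc j n)) Lj , inj₂ p^n≤)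
      ... | inj₂ ≤p^n = inj₂ (2 ℕ.+ j , n , subst (U δ) (sym (/-suc (2 ℕ.+ j) n)) Uj ,
              ℚ.<⇒≤ (ℚ.<-trans 0<p p<q) ,
              jump k d j {ℕ⇒ℚ N} {p} {q} (0≤ℕ⇒ℚ N) (0or1≤ N) (ℚ.<⇒≤ 0<p) gap ≤p^n)

{-# OPTIONS --safe #-}

-- Let s = ⌊√N⌋ and let p ≤ s - 1 be the prime of the gap hypothesis with δ = ε.
-- Then p² + p + 1 ≤ s² ≤ N, so the residues in {1,…,p² + p + 1} of a Singer set
-- form a Sidon subset of {1,…,N} with p + 1 elements.  Hence
-- h(N) ≥ p + 1 > s - (s - 1)^ε ≥ √N - 1 - N^ε ≥ √N - 2 N^ε.

module Submission where

open import Defs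
open RationalLemmas
open ℝ
open RealLemmas using (L<U)
open import Data.Integer as ℤ using (ℤ; +_)
import Data.Integer.DivMod as ℤ
import Data.Integer.Divisibility.Signed as Signed
import Data.Integer.Properties as ℤ
import Data.Integer.Solver as ℤ
open import Algebra.Properties.CommutativeSemigroup ℤ.+-commutativeSemigroup using (interchange)
open import Data.List using (List; []; _∷_; _++_; map; filter; length)
import Data.List.Membership.DecPropositional as DecMembership
open import Data.List.Membership.Propositional using (_∈_)
open import Data.List.Membership.Propositional.Properties
open import Data.List.Properties using (foldr-preservesᵒ; length-map; length-++-sucʳ)
open import Data.List.Relation.Binary.Subset.Propositional using (_⊆_)
import Data.List.Relation.Unary.All as All
import Data.List.Relation.Unary.All.Properties as All
open import Data.List.Relation.Unary.AllPairs using ([]; _∷_)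
open import Data.List.Relation.Unary.Any as Any using (here; there)
open import Data.List.Relation.Unary.Unique.Propositional using (Unique)
open import Data.Nat as ℕ using (ℕ; zero; suc; s≤s; z≤n)
open import Data.Nat.Primality using (Prime)
import Data.Nat.Properties as ℕ
open import Data.Nat.Tactic.RingSolver using (solve-∀)
open import Data.Product using (∃; ∃₂; _×_; _,_; proj₂)
open import Data.Rational as ℚ using (ℚ; 0ℚ; 1ℚ)
import Data.Rational.Properties as ℚ
open import Data.Rational.Solver using (module +-*-Solver)
open import Data.Sum using (inj₁; inj₂)
open import Function using (_∘_)
open import Relation.Binary.PropositionalEquality
open import Relation.Nullary using (yes; no; contradiction)
open import Relation.Unary using (Decidable)

-- Finite sets as lists, and lower bounds for `h`.

module _ {A : Set} where

  -- Induction on `xs`: deleting one occurrence of the head from `ys` keeps the tail included, since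
  -- no entry of the tail equals the head.
  length-mono-⊆ : ∀ {xs ys : List A} → Unique xs → xs ⊆ ys → length xs ℕ.≤ length ys
  length-mono-⊆ [] _ = z≤n
  length-mono-⊆ {x ∷ xs} (x∉xs ∷ xs!) x∷xs⊆ys with ∈-∃++ (x∷xs⊆ys (here refl))
  ... | us , vs , refl = subst (suc (length xs) ℕ.≤_) (sym (length-++-sucʳ us x vs))
      (s≤s (length-mono-⊆ xs! λ y∈xs →
        avoid us (All.lookup x∉xs y∈xs) (x∷xs⊆ys (there y∈xs))))
    where
    avoid : ∀ us {y} → x ≢ y → y ∈ us ++ x ∷ vs → y ∈ us ++ vs
    avoid us x≢y y∈ with ∈-++⁻ us y∈
    ... | inj₁ y∈us         = ∈-++⁺ˡ y∈us
    ... | inj₂ (here y≡x)   = contradiction (sym y≡x) x≢y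
    ... | inj₂ (there y∈vs) = ∈-++⁺ʳ us y∈vs

  Unique-map : ∀ {B : Set} {f : A → B} {xs} →
    (∀ {x y} → x ∈ xs → y ∈ xs → f x ≡ f y → x ≡ y) → Unique xs → Unique (map f xs)
  Unique-map inj [] = []
  Unique-map inj (x∉xs ∷ xs!) =
    All.map⁺ (All.tabulate λ y∈xs fx≡fy →
      All.lookup x∉xs y∈xs (inj (here refl) (there y∈xs) fx≡fy))
    ∷ Unique-map (λ x∈ y∈ → inj (there x∈) (there y∈)) xs!

  filter∈sublists : ∀ {P : A → Set} (P? : Decidable P) xs → filter P? xs ∈ sublists xs
  filter∈sublists P? [] = here refl
  filter∈sublists P? (x ∷ xs) with P? x
  ... | yes _ = ∈-++⁺ʳ (sublists xs) (∈-map⁺ (x ∷_) (filter∈sublists P? xs))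
  ... | no  _ = ∈-++⁺ˡ (filter∈sublists P? xs)

Sidon-⊆ : ∀ {A B} → A ⊆ B → Sidon B → Sidon A
Sidon-⊆ A⊆B sidon a∈ b∈ c∈ d∈ = sidon (A⊆B a∈) (A⊆B b∈) (A⊆B c∈) (A⊆B d∈)

-- `A` may list its elements in any order, so it need not occur among the sublists of `[1⋯ N ]`. Its
-- rearrangement `B` does occur, is Sidon because `B ⊆ A`, and is at least as long because `A ⊆ B`.
Sidon⇒length≤h : ∀ {A N} → Unique A → A ⊆ [1⋯ N ] → Sidon A → length A ℕ.≤ h N
Sidon⇒length≤h {A} {N} A! A⊆N sidon = ℕ.≤-trans
  (length-mono-⊆ A! λ a∈A → ∈-filter⁺ (_∈? A) (A⊆N a∈A) a∈A)
  (foldr-preservesᵒ {P = length B ℕ.≤_} (λ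
      { m n (inj₁ ≤m) → ℕ.≤-trans ≤m (ℕ.m≤m⊔n m n)
      ; m n (inj₂ ≤n) → ℕ.≤-trans ≤n (ℕ.m≤n⊔m m n) })
    0 _ (inj₂ (Any.map ℕ.≤-reflexive (∈-map⁺ length
      (∈-filter⁺ sidon? (filter∈sublists (_∈? A) [1⋯ N ])
        (Sidon-⊆ (λ b∈B → proj₂ (∈-filter⁻ (_∈? A) {xs = [1⋯ N ]} b∈B)) sidon))))))
  where
  open DecMembership ℤ._≟_ using (_∈?_)
  B = filter (_∈? A) [1⋯ N ]

-- From Sidon sets modulo `M` to Sidon sets of integers.

module _ (M : ℕ) .{{_ : ℕ.NonZero M}} where

  -- Shifting down before the reduction and up after it gives representatives in {1,...,M} instead
  -- of {0,...,M-1}.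
  residue : ℤ → ℤ
  residue a = + suc (ℤ.pred a ℤ.%ℕ M)

  residue∈ : ∀ {N} → M ℕ.≤ N → ∀ a → residue a ∈ [1⋯ N ]
  residue∈ M≤N a = ∈-map⁺ (λ i → + suc i) (∈-upTo⁺ (ℕ.<-≤-trans (ℤ.n%ℕd<d (ℤ.pred a) M) M≤N))

  -- Each integer is its residue plus a multiple `m` of `M`. The equal residue sums cancel, which
  -- leaves a combination of such multiples.
  residue-sums : ∀ a b c d → residue a ℤ.+ residue b ≡ residue c ℤ.+ residue d →
    + M Signed.∣ (a ℤ.+ b) ℤ.- (c ℤ.+ d)
  residue-sums a b c d eq = subst (+ M Signed.∣_) (sym (begin
    (a ℤ.+ b) ℤ.- (c ℤ.+ d)
      ≡⟨ cong₂ ℤ._-_ (sum-split a b) (sum-split c d) ⟩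
    (residue a ℤ.+ residue b ℤ.+ (m a ℤ.+ m b)) ℤ.- (residue c ℤ.+ residue d ℤ.+ (m c ℤ.+ m d))
      ≡⟨ cong (λ z → (z ℤ.+ (m a ℤ.+ m b)) ℤ.- (residue c ℤ.+ residue d ℤ.+ (m c ℤ.+ m d))) eq ⟩
    (residue c ℤ.+ residue d ℤ.+ (m a ℤ.+ m b)) ℤ.- (residue c ℤ.+ residue d ℤ.+ (m c ℤ.+ m d))
      ≡⟨ cancel (residue c ℤ.+ residue d) (m a ℤ.+ m b) (m c ℤ.+ m d) ⟩
    (m a ℤ.+ m b) ℤ.- (m c ℤ.+ m d) ∎))
    (Signed.∣m∣n⇒∣m-n (Signed.∣m∣n⇒∣m+n (M∣m a) (M∣m b)) (Signed.∣m∣n⇒∣m+n (M∣m c) (M∣m d)))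
    where
    open ≡-Reasoning
    open ℤ.+-*-Solver
    cancel : ∀ i j k → (i ℤ.+ j) ℤ.- (i ℤ.+ k) ≡ j ℤ.- k
    cancel = solve 3 (λ i j k → (i :+ j) :- (i :+ k) := j :- k) refl
    m : ℤ → ℤ
    m a = ℤ.pred a ℤ./ℕ M ℤ.* + M
    M∣m : ∀ a → + M Signed.∣ m a
    M∣m a = Signed.divides (ℤ.pred a ℤ./ℕ M) refl
    split : ∀ a → a ≡ residue a ℤ.+ m a
    split a = begin
      a                                              ≡⟨ ℤ.suc-pred a ⟨
      ℤ.suc (ℤ.pred a)                               ≡⟨ cong ℤ.suc (ℤ.a≡a%ℕn+[a/ℕn]*n (ℤ.pred a) M) ⟩
      ℤ.suc (+ (ℤ.pred a ℤ.%ℕ M) ℤ.+ m a)            ≡⟨ ℤ.+-assoc (+ 1) (+ (ℤ.pred a ℤ.%ℕ M)) (m a) ⟨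
      residue a ℤ.+ m a                              ∎
    sum-split : ∀ a b → a ℤ.+ b ≡ residue a ℤ.+ residue b ℤ.+ (m a ℤ.+ m b)
    sum-split a b = trans (cong₂ ℤ._+_ (split a) (split b))
      (interchange (residue a) (m a) (residue b) (m b))

  module _ {S : List ℤ} (sidon : SidonMod M S) where

    samePair : ∀ {a b c d} → a ∈ S → b ∈ S → c ∈ S → d ∈ S →
      residue a ℤ.+ residue b ≡ residue c ℤ.+ residue d → SamePair a b c d
    samePair {a} {b} {c} {d} a∈ b∈ c∈ d∈ =
      sidon a∈ b∈ c∈ d∈ ∘ Signed.∣⇒∣ᵤ ∘ residue-sums a b c d

    -- The Sidon property for `a + a` against `a + b` forces `a ≡ b` in either matching. Hence
    -- passing to residues loses no elements of `S`.
    residue-injective : ∀ {a b} → a ∈ S → b ∈ S → residue a ≡ residue b → a ≡ b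
    residue-injective {a} a∈ b∈ eq with samePair a∈ a∈ a∈ b∈ (cong (λ z → residue a ℤ.+ z) eq)
    ... | inj₁ (_ , a≡b) = a≡b
    ... | inj₂ (a≡b , _) = a≡b

    residues-Sidon : Sidon (map residue S)
    residues-Sidon a∈ b∈ c∈ d∈ eq
      with ∈-map⁻ residue a∈ | ∈-map⁻ residue b∈ | ∈-map⁻ residue c∈ | ∈-map⁻ residue d∈
    ... | _ , a∈S , refl | _ , b∈S , refl | _ , c∈S , refl | _ , d∈S , refl
      with samePair a∈S b∈S c∈S d∈S eq
    ... | inj₁ (a≡c , b≡d) = inj₁ (cong residue a≡c , cong residue b≡d)
    ... | inj₂ (a≡d , b≡c) = inj₂ (cong residue a≡d , cong residue b≡c)

    SidonMod⇒length≤h : ∀ {N} → Unique S → M ℕ.≤ N → length S ℕ.≤ h N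
    SidonMod⇒length≤h {N} S! M≤N = subst (ℕ._≤ h N) (length-map residue S)
      (Sidon⇒length≤h (Unique-map residue-injective S!) ⊆N residues-Sidon)
      where
      ⊆N : map residue S ⊆ [1⋯ N ]
      ⊆N a∈ with ∈-map⁻ residue a∈
      ... | a , _ , refl = residue∈ M≤N a

-- Integer square roots and room for the modulus.

⌊√_⌋ : ∀ N → ∃ λ s → s ℕ.* s ℕ.≤ N × N ℕ.< suc s ℕ.* suc s
⌊√ zero  ⌋ = 0 , z≤n , s≤s z≤n
⌊√ suc N ⌋ with ⌊√ N ⌋
... | s , s²≤N , N<[1+s]² with suc N ℕ.<? suc s ℕ.* suc s
... | yes 1+N<[1+s]² = s , ℕ.m≤n⇒m≤1+n s²≤N , 1+N<[1+s]²
... | no  1+N≮[1+s]² = suc s , ℕ.≮⇒≥ 1+N≮[1+s]² ,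
      -- `N < (1+s)²` unfolds to `suc N ≤ (1+s)²`, and (1+s)² < (2+s)².
      ℕ.≤-<-trans N<[1+s]² (ℕ.*-mono-< (ℕ.n<1+n (suc s)) (ℕ.n<1+n (suc s)))

-- Here `x` is ⌊√N⌋ - 1. The bound on `N` makes ⌊√N⌋ exceed `x₀`, so the predecessor exists and is
-- still at least `x₀`.
√-pred : ∀ {x₀ N} → suc x₀ ℕ.* suc x₀ ℕ.≤ N →
  ∃ λ x → x₀ ℕ.≤ x × suc x ℕ.* suc x ℕ.≤ N × N ℕ.< (2 ℕ.+ x) ℕ.* (2 ℕ.+ x)
√-pred {x₀} {N} [1+x₀]²≤N with ⌊√ N ⌋
... | s , s²≤N , N<[1+s]² with s ℕ.≤? x₀
... | yes s≤x₀ = contradiction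
        (ℕ.<-≤-trans N<[1+s]² (ℕ.≤-trans (ℕ.*-mono-≤ (s≤s s≤x₀) (s≤s s≤x₀)) [1+x₀]²≤N))
        (ℕ.<-irrefl refl)
√-pred _ | zero  , _    , _        | no s≰x₀ = contradiction z≤n s≰x₀
√-pred _ | suc x , s²≤N , N<[1+s]² | no s≰x₀ = x , ℕ.≤-pred (ℕ.≰⇒> s≰x₀) , s²≤N , N<[1+s]²

p²+p+1≤[1+x]² : ∀ {p x} → p ℕ.≤ x → p ℕ.* p ℕ.+ p ℕ.+ 1 ℕ.≤ suc x ℕ.* suc x
p²+p+1≤[1+x]² {p} {x} p≤x = begin
  p ℕ.* p ℕ.+ p ℕ.+ 1        ≤⟨ ℕ.+-monoˡ-≤ 1 (ℕ.+-mono-≤ (ℕ.*-mono-≤ p≤x p≤x) p≤x) ⟩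
  -- The gap between x² + x + 1 and (1+x)² is exactly `x`.
  x ℕ.* x ℕ.+ x ℕ.+ 1        ≤⟨ ℕ.m≤n+m _ x ⟩
  x ℕ.+ (x ℕ.* x ℕ.+ x ℕ.+ 1) ≡⟨ square x ⟩
  suc x ℕ.* suc x            ∎
  where
  open ℕ.≤-Reasoning
  square : ∀ x → x ℕ.+ (x ℕ.* x ℕ.+ x ℕ.+ 1) ≡ suc x ℕ.* suc x
  square = solve-∀

-- Rational bounds extracted from the cuts.

ℕ⇒ℚ-+ : ∀ m n → ℕ⇒ℚ (m ℕ.+ n) ≡ ℕ⇒ℚ m ℚ.+ ℕ⇒ℚ n
ℕ⇒ℚ-+ zero    n = sym (ℚ.+-identityˡ (ℕ⇒ℚ n))
ℕ⇒ℚ-+ (suc m) n = begin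
  ℕ⇒ℚ (suc (m ℕ.+ n))          ≡⟨ ℕ⇒ℚ-suc (m ℕ.+ n) ⟩
  1ℚ ℚ.+ ℕ⇒ℚ (m ℕ.+ n)         ≡⟨ cong (1ℚ ℚ.+_) (ℕ⇒ℚ-+ m n) ⟩
  1ℚ ℚ.+ (ℕ⇒ℚ m ℚ.+ ℕ⇒ℚ n)     ≡⟨ ℚ.+-assoc 1ℚ (ℕ⇒ℚ m) (ℕ⇒ℚ n) ⟨
  1ℚ ℚ.+ ℕ⇒ℚ m ℚ.+ ℕ⇒ℚ n       ≡⟨ cong (ℚ._+ ℕ⇒ℚ n) (ℕ⇒ℚ-suc m) ⟨
  ℕ⇒ℚ (suc m) ℚ.+ ℕ⇒ℚ n        ∎
  where open ≡-Reasoning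

ℕ⇒ℚ-* : ∀ m n → ℕ⇒ℚ (m ℕ.* n) ≡ ℕ⇒ℚ m ℚ.* ℕ⇒ℚ n
ℕ⇒ℚ-* zero    n = sym (ℚ.*-zeroˡ (ℕ⇒ℚ n))
ℕ⇒ℚ-* (suc m) n = begin
  ℕ⇒ℚ (n ℕ.+ m ℕ.* n)                  ≡⟨ ℕ⇒ℚ-+ n (m ℕ.* n) ⟩
  ℕ⇒ℚ n ℚ.+ ℕ⇒ℚ (m ℕ.* n)              ≡⟨ cong₂ ℚ._+_ (sym (ℚ.*-identityˡ (ℕ⇒ℚ n))) (ℕ⇒ℚ-* m n) ⟩
  1ℚ ℚ.* ℕ⇒ℚ n ℚ.+ ℕ⇒ℚ m ℚ.* ℕ⇒ℚ n     ≡⟨ ℚ.*-distribʳ-+ (ℕ⇒ℚ n) 1ℚ (ℕ⇒ℚ m) ⟨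
  (1ℚ ℚ.+ ℕ⇒ℚ m) ℚ.* ℕ⇒ℚ n             ≡⟨ cong (ℚ._* ℕ⇒ℚ n) (ℕ⇒ℚ-suc m) ⟨
  ℕ⇒ℚ (suc m) ℚ.* ℕ⇒ℚ n                ∎
  where open ≡-Reasoning

L-fromℚ : ∀ {x q} → L (fromℚ x) q → q ℚ.< x
L-fromℚ (_ , q<r , r≤x) = ℚ.<-≤-trans q<r r≤x

U-fromℚ : ∀ {x q} → U (fromℚ x) q → x ℚ.< q
U-fromℚ (_ , r<q , x≤r) = ℚ.≤-<-trans x≤r r<q

L-minus : ∀ x y {q} → L (x - y) q → ∃₂ λ a b → L x a × U y b × q ℚ.< a ℚ.- b
L-minus x y {q} (r , q<r , a , c , a<x , y<-c , r≤a+c) = a , ℚ.- c , a<x , y<-c ,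
  ℚ.<-≤-trans q<r (subst (r ℚ.≤_) (solve 2 (λ a c → a :+ c := a :- :- c) refl a c) r≤a+c)
  where open +-*-Solver

U-minus : ∀ x y {q} → U (x - y) q → ∃₂ λ a b → U x a × L y b × a ℚ.- b ℚ.< q
U-minus x y {q} (r , r<q , a , c , x<a , -c<y , a+c≤r) = a , ℚ.- c , x<a , -c<y ,
  ℚ.≤-<-trans (subst (ℚ._≤ r) (solve 2 (λ a c → a :+ c := a :- :- c) refl a c) a+c≤r) r<q
  where open +-*-Solver

-- The bound on products over the rectangle is evaluated at the point `(x , d)` of its top edge.
U-scale : ∀ x y {q} → U (fromℚ x * y) q → ∃ λ d → U y d × x ℚ.* d ℚ.< q
U-scale x y (r , r<q , R , ≤r) = Box.d R , Box.y<d R , ℚ.≤-<-trans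
  (≤r ((ℚ.<⇒≤ (L-fromℚ (Box.a<x R)) , ℚ.<⇒≤ (U-fromℚ (Box.x<b R))) ,
       (ℚ.<⇒≤ (L<U y (Box.c<y R) (Box.y<d R)) , ℚ.≤-refl))) r<q

L-√ : ∀ {N s q} → N ℕ.≤ s ℕ.* s → L (√ N) q → q ℚ.≤ ℕ⇒ℚ s
L-√ {N} {s} N≤s² (r , q<r , inj₁ r≤0) = ℚ.≤-trans (ℚ.<⇒≤ q<r) (ℚ.≤-trans r≤0 (0≤ℕ⇒ℚ s))
L-√ {N} {s} N≤s² (r , q<r , inj₂ r²≤N) = ℚ.≤-trans (ℚ.<⇒≤ q<r) (^-cancel-≤ 1 (0≤ℕ⇒ℚ s) (begin
  r ^ℚ 2             ≤⟨ r²≤N ⟩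
  ℕ⇒ℚ N              ≤⟨ ℕ⇒ℚ-mono-≤ N≤s² ⟩
  ℕ⇒ℚ (s ℕ.* s)      ≡⟨ ℕ⇒ℚ-* s s ⟩
  ℕ⇒ℚ s ℚ.* ℕ⇒ℚ s    ≡⟨ cong (ℕ⇒ℚ s ℚ.*_) (ℚ.*-identityʳ (ℕ⇒ℚ s)) ⟨
  ℕ⇒ℚ s ^ℚ 2         ∎))
  where open ℚ.≤-Reasoning

-- A lower witness for the smaller base serves for the larger one with the same exponent `m / n`.
pow-mono : ∀ {M N δ} {0<δ : 0ℝ < δ} → M ℕ.≤ N → pow M δ 0<δ ≤ pow N δ 0<δ
pow-mono M≤N (r , q<r , m , n , m/n<δ , inj₁ r≤0) = r , q<r , m , n , m/n<δ , inj₁ r≤0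
pow-mono {M} M≤N (r , q<r , m , n , m/n<δ , inj₂ r^n≤M^m) =
  r , q<r , m , n , m/n<δ ,
  inj₂ (ℚ.≤-trans r^n≤M^m (^-mono-≤ (suc m) (0≤ℕ⇒ℚ M) (ℕ⇒ℚ-mono-≤ M≤N)))

-- This lets a power of `N` absorb an additive constant: `r` satisfies `r ^ n ≥ N ^ m ≥ 1` for
-- suitable positive exponents, and `q` lies above `r`.
U-pow : ∀ {N δ} {0<δ : 0ℝ < δ} → 1 ℕ.≤ N → ∀ {q} → U (pow N δ 0<δ) q → 1ℚ ℚ.< q
U-pow {N} 1≤N (r , r<q , m , n , _ , 0≤r , N^m≤r^n) = ℚ.≤-<-trans
  (^-cancel-≤ n 0≤r (begin
    1ℚ ^ℚ suc n       ≤⟨ 1^≤1 (suc n) ⟩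
    1ℚ                ≤⟨ 1≤^ (suc m) (ℕ⇒ℚ-mono-≤ 1≤N) ⟩
    ℕ⇒ℚ N ^ℚ suc m    ≤⟨ N^m≤r^n ⟩
    r ^ℚ suc n        ∎)) r<q
  where
  open ℚ.≤-Reasoning
  1^≤1 : ∀ n → 1ℚ ^ℚ n ℚ.≤ 1ℚ
  1^≤1 zero    = ℚ.≤-refl
  1^≤1 (suc n) = subst (ℚ._≤ 1ℚ) (sym (ℚ.*-identityˡ (1ℚ ^ℚ n))) (1^≤1 n)

-- Combining the prime gap with the Singer sets.

√-error-bound : ∀ {x p N k : ℕ} {P P′ : ℝ} →
  N ℕ.≤ (2 ℕ.+ x) ℕ.* (2 ℕ.+ x) → P′ ≤ P → (∀ {q} → U P q → 1ℚ ℚ.< q) →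
  fromℕ x - P′ < fromℕ p → p ℕ.+ 1 ℕ.≤ k → fromℕ k ≥ √ N - fromℕ 2 * P
-- In the application `P` is N^ε and `P′` is x^ε. The real inequalities are reduced to rational
-- ones: `e` lies below `P′`, hence below `P`, and `d` lies above `P`, so `e < d`.
√-error-bound {x} {p} {N} {k} {P} {P′} N≤ P′≤P 1≤P (m , x-P′<m , m<p) p+1≤k {q} q< =
  let u , e , x<u , e<P′ , u-e<m = U-minus (fromℕ x) P′ x-P′<m
      a , b , a<√N , 2P<b , q<a-b = L-minus (√ N) (fromℕ 2 * P) q<
      d , P<d , 2d<b = U-scale (ℕ⇒ℚ 2) P 2P<b
  in ℕ⇒ℚ k , q<k (U-fromℚ x<u) u-e<m (L-fromℚ m<p) (L<U P (P′≤P e<P′) P<d)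
       q<a-b (L-√ N≤ a<√N) 2d<b (1≤P P<d) , ℚ.≤-refl
  where
  open ℚ.≤-Reasoning
  open +-*-Solver
  X = ℕ⇒ℚ x
  q<k : ∀ {u e m a b d} → X ℚ.< u → u ℚ.- e ℚ.< m → m ℚ.< ℕ⇒ℚ p → e ℚ.< d →
    q ℚ.< a ℚ.- b → a ℚ.≤ ℕ⇒ℚ (2 ℕ.+ x) → ℕ⇒ℚ 2 ℚ.* d ℚ.< b → 1ℚ ℚ.< d → q ℚ.< ℕ⇒ℚ k
  q<k {u} {e} {m} {a} {b} {d} x<u u-e<m m<p e<d q<a-b a≤2+x 2d<b 1<d = begin-strict
    q                                <⟨ q<a-b ⟩
    a ℚ.- b                          <⟨ ℚ.+-mono-≤-< a≤2+x (ℚ.neg-antimono-< 2d<b) ⟩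
    ℕ⇒ℚ (2 ℕ.+ x) ℚ.- ℕ⇒ℚ 2 ℚ.* d    ≡⟨ cong (ℚ._- ℕ⇒ℚ 2 ℚ.* d) (ℕ⇒ℚ-+ 2 x) ⟩
    -- One copy of `d` pays for the prime gap, as `X - d < p`; the other brings the constant 2 below
    -- 1, as `1 < d`.
    ℕ⇒ℚ 2 ℚ.+ X ℚ.- ℕ⇒ℚ 2 ℚ.* d      ≡⟨ solve 2 (λ X d → con (ℕ⇒ℚ 2) :+ X :- con (ℕ⇒ℚ 2) :* d
                                          := X :- d :+ (con (ℕ⇒ℚ 2) :- d)) refl X d ⟩
    X ℚ.- d ℚ.+ (ℕ⇒ℚ 2 ℚ.- d)        <⟨ ℚ.+-mono-< x-d<p
                                          (ℚ.+-monoʳ-< (ℕ⇒ℚ 2) (ℚ.neg-antimono-< 1<d)) ⟩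
    ℕ⇒ℚ p ℚ.+ ℕ⇒ℚ 1                  ≡⟨ ℕ⇒ℚ-+ p 1 ⟨
    ℕ⇒ℚ (p ℕ.+ 1)                    ≤⟨ ℕ⇒ℚ-mono-≤ p+1≤k ⟩
    ℕ⇒ℚ k                            ∎
    where
    x-d<p : X ℚ.- d ℚ.< ℕ⇒ℚ p
    x-d<p = begin-strict
      X ℚ.- d    <⟨ ℚ.+-mono-< x<u (ℚ.neg-antimono-< e<d) ⟩
      u ℚ.- e    <⟨ u-e<m ⟩
      m          <⟨ m<p ⟩
      ℕ⇒ℚ p      ∎

Singer⇒p+1≤h : (∀ p → Prime p →
    ∃ λ (S : List ℤ) → Unique S × length S ≡ p ℕ.+ 1 × SidonMod (p ℕ.* p ℕ.+ p ℕ.+ 1) S) →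
  ∀ {p N} → Prime p → p ℕ.* p ℕ.+ p ℕ.+ 1 ℕ.≤ N → p ℕ.+ 1 ℕ.≤ h N
Singer⇒p+1≤h singer {p} {N} p-prime M≤N with singer p p-prime
... | S , S! , |S|≡p+1 , sidon = subst (ℕ._≤ h N) |S|≡p+1
      (SidonMod⇒length≤h _ {{ℕ.≢-nonZero (ℕ.m+1+n≢0 (p ℕ.* p ℕ.+ p))}} sidon S! M≤N)

mainTheorem14 : (singer : ∀ p → Prime p →
    ∃ λ (S : List ℤ) → Unique S × length S ≡ p ℕ.+ 1 × SidonMod (p ℕ.* p ℕ.+ p ℕ.+ 1) S) →
    (primeGaps : ∀ (δ : ℝ) (0<δ : 0ℝ < δ) →
    ∃ λ (x₀ : ℕ) → ∀ (x : ℕ) → x ℕ.≥ x₀ →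
    ∃ λ (p : ℕ) → Prime p × fromℕ x - pow x δ 0<δ < fromℕ p × p ℕ.≤ x) →
    ∀ (ε : ℝ) (0<ε : 0ℝ < ε) →
    ∃ λ (C : ℝ) → C ≥ 0ℝ × (∃ λ (N₀ : ℕ) → ∀ (N : ℕ) → N ℕ.≥ N₀ →
    fromℕ (h N) ≥ √ N - C * pow N ε 0<ε)
mainTheorem14 singer primeGaps ε 0<ε =
  let x₀ , prime-below = primeGaps ε 0<ε
  -- C = 2 counts one N^ε for the prime gap and one for the rounding loss; N₀ = (1+x₀)² guarantees
  -- `x₀ ≤ x`.
  in fromℕ 2 , 2≥0 , suc x₀ ℕ.* suc x₀ , λ N N≥ →
    let x , x₀≤x , [1+x]²≤N , N<[2+x]² = √-pred {x₀} N≥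
        p , p-prime , x-x^ε<p , p≤x = prime-below x x₀≤x
        -- This crude comparison suffices to replace x^ε by N^ε in the error.
        x≤N = ℕ.≤-trans (ℕ.n≤1+n x) (ℕ.≤-trans (ℕ.m≤m*n (suc x) (suc x)) [1+x]²≤N)
    in √-error-bound {x} {p} {N} {h N} {pow N ε 0<ε} {pow x ε 0<ε} (ℕ.<⇒≤ N<[2+x]²)
         (pow-mono {x} {N} {ε} {0<ε} x≤N) (U-pow {N} {ε} {0<ε} (ℕ.≤-trans (s≤s z≤n) [1+x]²≤N))
         x-x^ε<p (Singer⇒p+1≤h singer p-prime (ℕ.≤-trans (p²+p+1≤[1+x]² p≤x) [1+x]²≤N))
  where
  2≥0 : fromℕ 2 ≥ 0ℝ
  2≥0 (r , q<r , r≤0) = r , q<r , ℚ.≤-trans r≤0 (0≤ℕ⇒ℚ 2)
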